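{- Let $G=(V,E)$ be a finite undirected, unweighted graph with $n=|V|$, let $v_1,v_2,\ldots,v_n$ be any ordering of $V$, and let $L'_n$ be the index produced by pruned landmark labeling with respect to this ordering. Then for any pair of vertices $s,t\in V$, $$\mathrm{Query}(s,t,L'_n)=d_G(s,t).$$
   Context: $d_G(u,v)$ is the shortest-path distance (number of edges) between $u$ and $v$ in $G$, with $d_G(u,v)=\infty$ if $u$ and $v$ are disconnected. $N_G(u)$ is the set of neighbors of $u$. An index $L$ assigns to each vertex $v$ a label $L(v)$, a finite set of pairs $(u,\delta_{uv})$ with $u\in V$ and $\delta_{uv}$ a distance value. For an index $L$, $$\mathrm{Query}(s,t,L)=\min\{\delta_{vs}+\delta_{vt}\mid (v,\delta_{vs})\in L(s),\ (v,\delta_{vt})\in L(t)\},$$ with value $\infty$ if $L(s)$ and $L(t)$ share no vertex. Pruned landmark labeling: $L'_0(u)=\emptyset$ for all $u\in V$. For $k=1,\ldots,n$, $L'_k$ is obtained from $L'_{k-1}$ by a pruned breadth-first search (BFS) from $v_k$: set $P[v_k]=0$ and $P[v]=\infty$ for all $v\neq v_k$, and start with a FIFO queue containing only $v_k$. While the queue is nonempty, dequeue a vertex $u$. If $\mathrm{Query}(v_k,u,L'_{k-1})\le P[u]$, then $u$ is pruned: nothing is added to its label and no edge from $u$ is traversed. Otherwise set $L'_k(u)=L'_{k-1}(u)\cup\{(v_k,P[u])\}$, and for every $w\in N_G(u)$ with $P[w]=\infty$ set $P[w]=P[u]+1$ and enqueue $w$. For every vertex $u$ that is pruned or not visited, $L'_k(u)=L'_{k-1}(u)$.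 -}

module Defs where

open import Data.Fin.Base using (Fin; zero; suc; toℕ; fromℕ<)
open import Data.Fin.Permutation using (Permutation′; _⟨$⟩ʳ_)
open import Data.Fin.Properties as Fin using (_≟_)
open import Data.List.Base as List
  using (List; []; _∷_; _++_; length; filter; allFin; cartesianProduct)
open import Data.List.Membership.Propositional using (_∈_)
open import Data.List.Membership.Propositional.Properties
  using (∈-filter⁺; ∈-filter⁻; ∈-allFin)
open import Data.List.Properties using (length-++)
open import Data.Nat.Base as ℕ using (ℕ; zero; suc; _+_; _∸_; _≤_; _<_; s≤s)
open import Data.Nat.Induction using (<-wellFounded; <-rec)
open import Data.Nat.Properties as ℕ
  using (≤-refl; ≤-reflexive; ≤-trans; <⇒≤; ≤-antisym; ≮⇒≥; +-assoc;
         +-monoˡ-<; m+[n∸m]≡n; m<1+n⇒m<n∨m≡n)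
open import Data.Product.Base using (∃; ∃-syntax; _×_; _,_; proj₁; proj₂)
open import Data.Sum.Base using (_⊎_; inj₁; inj₂)
open import Data.Vec.Functional using (updateAt)
open import Function.Base using (const; _∘_)
open import Function.Bundles using (_⇔_; mk⇔)
open import Induction.WellFounded using (Acc; acc)
open import Level using (0ℓ)
open import Relation.Binary.Bundles using (TotalOrder)
open import Relation.Binary.Core using (Rel)
open import Relation.Binary.Definitions using (Decidable; Symmetric)
import Relation.Binary.Construct.Add.Supremum.NonStrict as AddSupremum
open import Relation.Binary.PropositionalEquality
  using (_≡_; refl; sym; trans; cong; subst)
open import Relation.Nullary using (¬_; Dec; yes; no; contradiction)
open import Relation.Nullary.Construct.Add.Supremum using (_⁺; [_]; ⊤⁺)
open import Relation.Nullary.Decidable using (map′; _×-dec_)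

------------------------------------------------------------------------
-- Distance values

ℕ∞ : Set
ℕ∞ = ℕ ⁺

pattern ∞ = ⊤⁺

open AddSupremum _≤_ public using () renaming (_≤⁺_ to _≤∞_)

_≤∞?_ : Decidable _≤∞_
_≤∞?_ = AddSupremum.≤⁺-dec _≤_ ℕ._≤?_

≤∞-totalOrder : TotalOrder 0ℓ 0ℓ 0ℓ
≤∞-totalOrder = record
  { isTotalOrder = AddSupremum.≤⁺-isTotalOrder-≡ _≤_ ℕ.≤-isTotalOrder }

open import Data.List.Extrema ≤∞-totalOrder public using (min)

infixl 6 _+∞_

_+∞_ : ℕ∞ → ℕ∞ → ℕ∞
[ a ] +∞ [ b ] = [ a + b ]
[ _ ] +∞ ∞     = ∞
∞     +∞ _     = ∞

------------------------------------------------------------------------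
-- Graphs

record Graph (n : ℕ) : Set₁ where
  field
    Adj     : Rel (Fin n) 0ℓ
    Adj-sym : Symmetric Adj
    _Adj?_  : Decidable Adj

-- A listing of every neighbourhood, in an arbitrary order: the order in which
-- a search scans the neighbours of a vertex is not prescribed.
record NeighbourLists {n} (G : Graph n) : Set where
  open Graph G
  field
    N      : Fin n → List (Fin n)
    ∈N⇔Adj : ∀ u w → w ∈ N u ⇔ Adj u w

neighbourLists : ∀ {n} (G : Graph n) → NeighbourLists G
neighbourLists {n} G = record
  { N      = λ u → filter (u Adj?_) (allFin n)
  ; ∈N⇔Adj = λ u w → mk⇔ (proj₂ ∘ ∈-filter⁻ (u Adj?_) {xs = allFin n})
                         (∈-filter⁺ (u Adj?_) (∈-allFin w))
  }
  where open Graph G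

------------------------------------------------------------------------
-- Shortest-path distance

module _ {n} (G : Graph n) where

  open Graph G

  -- Walk k s t: a walk with k edges from s to t; vertices may repeat, which does
  -- not affect the least length.
  data Walk : ℕ → Rel (Fin n) 0ℓ where
    []  : ∀ {u} → Walk 0 u u
    _∷_ : ∀ {k u w t} → Adj u w → Walk k w t → Walk (suc k) u t

  IsDistance : Fin n → Fin n → ℕ∞ → Set
  IsDistance s t [ k ] = Walk k s t × (∀ j → Walk j s t → k ≤ j)
  IsDistance s t ∞     = ∀ k → ¬ Walk k s t

  IsDistance-unique : ∀ {s t d e} → IsDistance s t d → IsDistance s t e → d ≡ e
  IsDistance-unique {d = [ j ]} {[ k ]} (p , j≤) (q , k≤) =
    cong [_] (≤-antisym (j≤ k q) (k≤ j p))
  IsDistance-unique {d = [ j ]} {∞}     (p , _)  ¬q       = contradiction p (¬q j)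
  IsDistance-unique {d = ∞}     {[ k ]} ¬p       (q , _)  = contradiction q (¬p k)
  IsDistance-unique {d = ∞}     {∞}     _        _        = refl

  private
    walk? : ∀ k s t → Dec (Walk k s t)
    walk? zero    s t = map′ (λ { refl → [] }) (λ { [] → refl }) (s ≟ t)
    walk? (suc k) s t = map′ (λ { (_ , a , p) → a ∷ p }) (λ { (a ∷ p) → _ , a , p })
                             (Fin.any? λ w → (s Adj? w) ×-dec walk? k w t)

    append : ∀ {j k s u t} → Walk j s u → Walk k u t → Walk (j + k) s t
    append []      q = q
    append (a ∷ p) q = a ∷ append p q

    at : ∀ {k s t} → Walk k s t → Fin (suc k) → Fin n
    at {s = s} _       zero    = s
    at         (_ ∷ p) (suc i) = at p i

    take : ∀ {k s t} (p : Walk k s t) i → Walk (toℕ i) s (at p i)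
    take p       zero    = []
    take (a ∷ p) (suc i) = a ∷ take p i

    drop : ∀ {k s t} (p : Walk k s t) i → Walk (k ∸ toℕ i) (at p i) t
    drop p       zero    = p
    drop (_ ∷ p) (suc i) = drop p i

    cut : ∀ {k s t} → n ≤ k → Walk k s t → ∃[ j ] j < k × Walk j s t
    cut {k} {s} {t} n≤k p with Fin.pigeonhole (s≤s n≤k) (at p)
    ... | i , j , i<j , eq =
      toℕ i + (k ∸ toℕ j) , shorter ,
      append (take p i) (subst (λ u → Walk (k ∸ toℕ j) u t) (sym eq) (drop p j))
      where
      shorter : toℕ i + (k ∸ toℕ j) < k
      shorter = ≤-trans (+-monoˡ-< (k ∸ toℕ j) i<j)
                        (≤-reflexive (m+[n∸m]≡n (ℕ.≤-pred (Fin.toℕ<n j))))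

    shorten : ∀ {s t} k → Walk k s t → ∃[ j ] j < n × Walk j s t
    shorten {s} {t} = <-rec _ go
      where
      go : ∀ k → (∀ {j} → j < k → Walk j s t → ∃[ i ] i < n × Walk i s t) →
           Walk k s t → ∃[ i ] i < n × Walk i s t
      go k rec p with k ℕ.<? n
      ... | yes k<n = k , k<n , p
      ... | no  k≮n = let j , j<k , q = cut (≮⇒≥ k≮n) p in rec j<k q

    search : ∀ s t m → (∃[ k ] IsDistance s t [ k ]) ⊎ (∀ k → k < m → ¬ Walk k s t)
    search s t zero = inj₂ λ _ ()
    search s t (suc m) with search s t m
    ... | inj₁ d = inj₁ d
    ... | inj₂ none with walk? m s t
    ...   | yes p = inj₁ (m , p , λ j q → ≮⇒≥ λ j<m → none j j<m q)
    ...   | no ¬p = inj₂ λ k k<1+m → case k (m<1+n⇒m<n∨m≡n k<1+m)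
      where
      case : ∀ k → (k < m) ⊎ (k ≡ m) → ¬ Walk k s t
      case k (inj₁ k<m)  = none k k<m
      case k (inj₂ refl) = ¬p

  distance : ∀ s t → ∃ (IsDistance s t)
  distance s t with search s t n
  ... | inj₁ (k , isD) = [ k ] , isD
  ... | inj₂ none      = ∞ , λ k p → let j , j<n , q = shorten k p in none j j<n q

  d : Fin n → Fin n → ℕ∞
  d s t = proj₁ (distance s t)

------------------------------------------------------------------------
-- Indices

-- Finite sets of pairs are represented by lists.
Label : ℕ → Set
Label n = List (Fin n × ℕ∞)

Index : ℕ → Set
Index n = Fin n → Label n

Query : ∀ {n} → Fin n → Fin n → Index n → ℕ∞
Query s t L =
  min ∞ (List.map (λ ((_ , δₛ) , (_ , δₜ)) → δₛ +∞ δₜ)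
          (filter (λ ((v , _) , (w , _)) → v ≟ w)
            (cartesianProduct (L s) (L t))))

------------------------------------------------------------------------
-- Pruned breadth-first search

infixl 9 _[_≔_]

_[_≔_] : ∀ {A : Set} {n} → (Fin n → A) → Fin n → A → (Fin n → A)
f [ i ≔ x ] = updateAt f i (const x)

record State (n : ℕ) : Set where
  constructor ⟨_,_,_⟩
  field
    P     : Fin n → ℕ∞
    queue : List (Fin n)       -- head is dequeued, enqueuing is at the end
    L     : Index n            -- the index under construction

-- The measure that makes the search terminate: a vertex is enqueued only when
-- its P-value changes from ∞ to a finite value.
count∞ : ∀ {n} → (Fin n → ℕ∞) → ℕ
count∞ {zero}  P = 0
count∞ {suc n} P with P zero
... | ∞     = suc (count∞ (P ∘ suc))
... | [ _ ] = count∞ (P ∘ suc)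

size : ∀ {n} → (Fin n → ℕ∞) → List (Fin n) → ℕ
size P q = length q + count∞ P

scan : ∀ {n} → ℕ∞ → List (Fin n) → (Fin n → ℕ∞) → List (Fin n) →
       (Fin n → ℕ∞) × List (Fin n)
scan δ []       P q = P , q
scan δ (w ∷ ws) P q with P w
... | ∞     = scan δ ws (P [ w ≔ δ ]) (q ++ w ∷ [])
... | [ _ ] = scan δ ws P q

private
  count∞-≔ : ∀ {n} (P : Fin n → ℕ∞) w {k} → P w ≡ ∞ →
             suc (count∞ (P [ w ≔ [ k ] ])) ≡ count∞ P
  count∞-≔ P zero    eq rewrite eq = refl
  count∞-≔ P (suc w) eq with P zero
  ... | ∞     = cong suc (count∞-≔ (P ∘ suc) w eq)
  ... | [ _ ] = count∞-≔ (P ∘ suc) w eq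

  size-enqueue : ∀ {n} (P : Fin n → ℕ∞) q w {k} → P w ≡ ∞ →
                 size (P [ w ≔ [ k ] ]) (q ++ w ∷ []) ≡ size P q
  size-enqueue P q w {k} eq
    rewrite length-++ q {w ∷ []}
          | +-assoc (length q) 1 (count∞ (P [ w ≔ [ k ] ]))
          | count∞-≔ P w {k} eq = refl

  size-scan : ∀ {n} k ws (P : Fin n → ℕ∞) q →
              let P′ , q′ = scan [ k ] ws P q in size P′ q′ ≡ size P q
  size-scan k []       P q = refl
  size-scan k (w ∷ ws) P q with P w in eq
  ... | ∞     = trans (size-scan k ws (P [ w ≔ [ k ] ]) (q ++ w ∷ []))
                      (size-enqueue P q w eq)
  ... | [ _ ] = size-scan k ws P q

module PrunedBFS {n} {G : Graph n} (nbrs : NeighbourLists G)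
                 (vₖ : Fin n) (Lₖ₋₁ : Index n) where

  open NeighbourLists nbrs

  -- One iteration of the loop, once u has been dequeued, leaving q.
  step : Fin n → State n → State n
  step u ⟨ P , q , L ⟩ with Query vₖ u Lₖ₋₁ ≤∞? P u
  ... | yes _ = ⟨ P , q , L ⟩
  ... | no  _ = let P′ , q′ = scan (P u +∞ [ 1 ]) (N u) P q in
                ⟨ P′ , q′ , L [ u ≔ (vₖ , P u) ∷ Lₖ₋₁ u ] ⟩

  private
    size-step : ∀ u P q L → let ⟨ P′ , q′ , _ ⟩ = step u ⟨ P , q , L ⟩ in
                size P′ q′ ≡ size P q
    size-step u P q L with Query vₖ u Lₖ₋₁ ≤∞? P u
    ... | yes _ = refl
    ... | no  Q≰Pu with P u
    ...   | ∞     = contradiction (_ AddSupremum.≤⊤⁺) Q≰Pu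
    ...   | [ k ] = size-scan (k + 1) (N u) P q

  step-decreases : ∀ u P q L → let ⟨ P′ , q′ , _ ⟩ = step u ⟨ P , q , L ⟩ in
                   size P′ q′ < size P (u ∷ q)
  step-decreases u P q L = s≤s (≤-reflexive (size-step u P q L))

  loop : (st : State n) → Acc _<_ (size (State.P st) (State.queue st)) → State n
  loop st@(⟨ _ , [] , _ ⟩)  _        = st
  loop ⟨ P , u ∷ q , L ⟩    (acc rs) =
    loop (step u ⟨ P , q , L ⟩) (rs (step-decreases u P q L))

  init : State n
  init = ⟨ const ∞ [ vₖ ≔ [ 0 ] ] , vₖ ∷ [] , Lₖ₋₁ ⟩

  result : Index n
  result = State.L (loop init (<-wellFounded _))

------------------------------------------------------------------------
-- Pruned landmark labeling

-- Positions in the ordering are numbered from 0, so the vertex processed in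
-- round k + 1 is the one at position k.
module PrunedLandmarkLabeling {n} {G : Graph n} (nbrs : NeighbourLists G)
                              (v : Permutation′ n) where

  L′ : ∀ k → k ≤ n → Index n
  L′ zero    _   = λ _ → []
  L′ (suc k) k<n = PrunedBFS.result nbrs (v ⟨$⟩ʳ fromℕ< k<n) (L′ k (<⇒≤ k<n))

  L′ₙ : Index n
  L′ₙ = L′ n ≤-refl

{-# OPTIONS --safe #-}

-- Labels only record lengths of actual walks, so Query never underestimates.
-- Conversely, fix a walk from s to t of length k and call x good if there are
-- walks from x to s and from x to t of total length at most k.  Take the good x
-- of least rank.  If the search from x were to prune a vertex u on its walk to
-- s, the hub y responsible would have smaller rank and, with its two labels
-- replacing the part of the walk from x to u, would again be good.  So x is a
-- hub of s, and likewise of t, and the query is at most k.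
module Submission where

open import Defs
open import Data.Fin.Base using (Fin; toℕ; fromℕ<)
open import Data.Fin.Permutation
  using (Permutation′; _⟨$⟩ʳ_; _⟨$⟩ˡ_; inverseˡ; inverseʳ)
open import Data.Fin.Properties using (_≟_; toℕ<n; toℕ-fromℕ<; fromℕ<-toℕ)
open import Data.List.Base using (List; []; _∷_; _++_; cartesianProduct)
open import Data.List.Extrema ≤∞-totalOrder using (min≤xs; argmin-sel)
open import Data.List.Membership.Propositional using (_∈_)
open import Data.List.Membership.Propositional.Properties
  using (∈-map⁺; ∈-map⁻; ∈-filter⁺; ∈-filter⁻; ∈-cartesianProduct⁺;
         ∈-cartesianProduct⁻; ∈-++⁺ˡ; ∈-++⁺ʳ)
open import Data.List.Properties using (++-assoc; ++-identityʳ)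
open import Data.List.Relation.Unary.All as All using (All; []; _∷_)
open import Data.List.Relation.Unary.All.Properties using (++⁺)
open import Data.List.Relation.Unary.Any using (here; there)
open import Data.Nat.Base using (ℕ; suc; _+_; _≤_; _<_; z≤n; s≤s)
open import Data.Nat.Induction using (<-wellFounded)
open import Data.Nat.Properties
  using (≤-refl; ≤-reflexive; ≤-trans; <⇒≤; m≤m+n; m≤n⇒m≤1+n; m≤n⇒m<n∨m≡n; +-comm;
         +-assoc; +-monoˡ-≤; +-mono-≤; ≤-irrelevant; module ≤-Reasoning)
open import Data.Nat.Tactic.RingSolver using (solve-∀)
open import Data.Product.Base using (∃-syntax; _×_; _,_; proj₁; proj₂)
open import Data.Sum.Base using (_⊎_; inj₁; inj₂)
open import Data.Vec.Functional.Properties using (updateAt-updates; updateAt-minimal)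
open import Function.Base using (const; _∘_)
open import Function.Bundles using (Equivalence)
open import Induction.WellFounded using (Acc; acc)
open import Relation.Binary.Construct.Add.Supremum.NonStrict _≤_
  using ([_]; [≤]-injective; ≤⁺-trans)
open import Relation.Binary.PropositionalEquality
  using (_≡_; refl; sym; trans; cong; subst)
open import Relation.Nullary using (¬_; yes; no; contradiction)
open import Relation.Nullary.Construct.Add.Supremum using ([_])
open import Relation.Nullary.Decidable using (decidable-stable)

private
  variable
    n : ℕ

-- Queries as minima over common hubs

-- A finite minimum cannot be the default value `∞`, so it comes from the list.
min-attained : ∀ {δs k} → min ∞ δs ≡ [ k ] → [ k ] ∈ δs
min-attained {δs} eq with argmin-sel (λ δ → δ) ∞ δs
... | inj₁ min≡∞ = contradiction (trans (sym eq) min≡∞) λ ()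
... | inj₂ min∈  = subst (_∈ δs) eq min∈

≤∞-finite : ∀ {δ i} → δ ≤∞ [ i ] → ∃[ j ] δ ≡ [ j ] × j ≤ i
≤∞-finite [ j≤i ] = _ , refl , j≤i

module _ (L : Index n) (s t : Fin n) where

  Query-≤ : ∀ {x δₛ δₜ} → (x , δₛ) ∈ L s → (x , δₜ) ∈ L t →
            Query s t L ≤∞ δₛ +∞ δₜ
  Query-≤ s∋ t∋ =
    All.lookup (min≤xs ∞ _)
      (∈-map⁺ _ (∈-filter⁺ _ (∈-cartesianProduct⁺ s∋ t∋) refl))

  Query-attained : ∀ {k} → Query s t L ≡ [ k ] →
                   ∃[ x ] ∃[ δₛ ] ∃[ δₜ ]
                     (x , δₛ) ∈ L s × (x , δₜ) ∈ L t × δₛ +∞ δₜ ≡ [ k ]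
  Query-attained eq with ∈-map⁻ {A = (Fin n × ℕ∞) × (Fin n × ℕ∞)} _ (min-attained eq)
  ... | ((x , δₛ) , (y , δₜ)) , ∈pairs , eq′
        with ∈-filter⁻ (λ ((x , _) , (y , _)) → x ≟ y)
                       {xs = cartesianProduct (L s) (L t)} ∈pairs
  ...   | ∈product , refl
          with ∈-cartesianProduct⁻ (L s) (L t) ∈product
  ...     | s∋ , t∋ = x , δₛ , δₜ , s∋ , t∋ , sym eq′

-- Assignments, neighbour scans and the FIFO queue

module _ {A : Set} (f : Fin n → A) (w : Fin n) {x : A} where

  ≔-inv : ∀ {v y} → (f [ w ≔ x ]) v ≡ y → (v ≡ w × x ≡ y) ⊎ f v ≡ y
  ≔-inv {v} eq with v ≟ w
  ... | yes refl = inj₁ (refl , trans (sym (updateAt-updates w f)) eq)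
  ... | no  v≢w  = inj₂ (trans (sym (updateAt-minimal v w f v≢w)) eq)

  -- Distinctness of `v` and `w` is read off from their different values: a scan assigns only where
  -- the value is `∞`, so finite values survive.
  ≔-extends : ∀ {v y z} → f w ≡ y → f v ≡ z → ¬ y ≡ z → (f [ w ≔ x ]) v ≡ z
  ≔-extends {v} fw fv y≢z =
    trans (updateAt-minimal v w f λ { refl → y≢z (trans (sym fw) fv) }) fv

[]-injective : ∀ {i j : ℕ} → _≡_ {A = ℕ∞} [ i ] [ j ] → i ≡ j
[]-injective refl = refl

Distances : ℕ → Set
Distances n = Fin n → ℕ∞

module _ {k : ℕ} where

  ≔-finite : ∀ (P : Distances n) w {v i} → P w ≡ ∞ → P v ≡ [ i ] →
             (P [ w ≔ [ k ] ]) v ≡ [ i ]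
  ≔-finite P w Pw Pv = ≔-extends P w Pw Pv λ ()

  -- Invariant rule for the scan: only an enqueue changes the state, and there `w` is known to be a
  -- listed neighbour with value `∞`.
  scan-preserves : ∀ (I : Distances n → List (Fin n) → Set) ws →
    (∀ {P q w} → w ∈ ws → P w ≡ ∞ → I P q → I (P [ w ≔ [ k ] ]) (q ++ w ∷ [])) →
    ∀ P q → I P q → let P′ , q′ = scan [ k ] ws P q in I P′ q′
  scan-preserves I []       pres P q i = i
  scan-preserves I (w ∷ ws) pres P q i with P w in eq
  ... | ∞     = scan-preserves I ws (pres ∘ there) _ _ (pres (here refl) eq i)
  ... | [ _ ] = scan-preserves I ws (pres ∘ there) _ _ i

  scan-finite : ∀ ws (P : Distances n) q {v i} → P v ≡ [ i ] →
                proj₁ (scan [ k ] ws P q) v ≡ [ i ]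
  scan-finite ws P q {v} {i} =
    scan-preserves (λ P′ _ → P′ v ≡ [ i ]) ws (λ {P} {_} {w} _ → ≔-finite P w) P q

  scan-covers : ∀ ws (P : Distances n) q {w} → w ∈ ws →
                ∃[ j ] proj₁ (scan [ k ] ws P q) w ≡ [ j ]
  scan-covers (w ∷ ws) P q w∈ with P w in eq
  scan-covers (w ∷ ws) P q (here refl) | ∞     =
    _ , scan-finite ws _ _ (updateAt-updates w P)
  scan-covers (w ∷ ws) P q (here refl) | [ _ ] = _ , scan-finite ws P q eq
  scan-covers (w ∷ ws) P q (there w∈)  | ∞     = scan-covers ws _ _ w∈
  scan-covers (w ∷ ws) P q (there w∈)  | [ _ ] = scan-covers ws _ _ w∈

-- Because the queue is FIFO, it holds vertices at level m, then at level m + 1;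
-- hence neighbours of a dequeued vertex that were reached before are not too far.
record Frontier (m : ℕ) (P : Distances n) (queue : List (Fin n)) : Set where
  field
    front back : List (Fin n)
    queue≡     : queue ≡ front ++ back
    front-at   : All (λ u → P u ≡ [ m ]) front
    back-at    : All (λ u → P u ≡ [ m + 1 ]) back
    bound      : ∀ {u i} → P u ≡ [ i ] → i ≤ m + 1

dequeue : ∀ {m} {P : Distances n} {u q} → Frontier m P (u ∷ q) →
          ∃[ m′ ] P u ≡ [ m′ ] × Frontier m′ P q
dequeue {m = m} record { front = _ ∷ f ; back = b ; queue≡ = refl
                       ; front-at = at ∷ fs ; back-at = bs ; bound = bound } =
  m , at , record { front = f ; back = b ; queue≡ = refl
                  ; front-at = fs ; back-at = bs ; bound = bound }
-- Level `m` is exhausted: the rest of `back` becomes the new front, and the level rises to `m + 1`.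
dequeue {m = m} record { front = [] ; back = _ ∷ b ; queue≡ = refl
                       ; back-at = at ∷ bs ; bound = bound } =
  m + 1 , at , record { front = b ; back = [] ; queue≡ = sym (++-identityʳ b)
                      ; front-at = bs ; back-at = []
                      ; bound = λ eq → ≤-trans (bound eq) (m≤m+n (m + 1) 1) }

enqueue : ∀ {m} {P : Distances n} {q w} → P w ≡ ∞ → Frontier m P q →
          Frontier m (P [ w ≔ [ m + 1 ] ]) (q ++ w ∷ [])
enqueue {m = m} {P} {w = w} Pw record { front = f ; back = b ; queue≡ = refl
                          ; front-at = fs ; back-at = bs ; bound = bound } =
  record { front = f ; back = b ++ w ∷ [] ; queue≡ = ++-assoc f b _
         ; front-at = All.map (≔-finite P w Pw) fs
         ; back-at = ++⁺ (All.map (≔-finite P w Pw) bs) (updateAt-updates w P ∷ [])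
         ; bound = λ eq → bound′ (≔-inv P w eq) }
  where
  bound′ : ∀ {u i} → (u ≡ w × _≡_ {A = ℕ∞} [ m + 1 ] [ i ]) ⊎ P u ≡ [ i ] → i ≤ m + 1
  bound′ (inj₁ (_ , refl)) = ≤-refl
  bound′ (inj₂ eq)         = bound eq

-- Walks

module _ {G : Graph n} where

  open Graph G

  infixr 5 _++ʷ_

  _++ʷ_ : ∀ {i j u v w} → Walk G i u v → Walk G j v w → Walk G (i + j) u w
  []      ++ʷ q = q
  (a ∷ p) ++ʷ q = a ∷ (p ++ʷ q)

  snoc : ∀ {i u v w} → Walk G i u v → Adj v w → Walk G (i + 1) u w
  snoc p a = p ++ʷ a ∷ []

  reverseʷ : ∀ {i u v} → Walk G i u v → Walk G i v u
  reverseʷ []                  = []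
  reverseʷ {u = u} {v} (_∷_ {k} a p) =
    subst (λ i → Walk G i v u) (+-comm k 1) (snoc (reverseʷ p) (Adj-sym a))

-- Invariant of a single pruned search

module BFSCorrectness {G : Graph n} (nbrs : NeighbourLists G)
                      (r : Fin n) (L₀ : Index n) where

  open Graph G
  open NeighbourLists nbrs
  open PrunedBFS nbrs r L₀

  Walks : Distances n → Set
  Walks P = ∀ {u i} → P u ≡ [ i ] → Walk G i r u

  -- What holds of a vertex once it has left the queue with value `i`: it was pruned, or it was
  -- labelled and all its neighbours have been reached at most one level later.
  Done : Distances n → Index n → Fin n → ℕ → Set
  Done P L u i =
    Query r u L₀ ≤∞ [ i ] ⊎
    ((r , [ i ]) ∈ L u × (∀ {w} → Adj u w → ∃[ j ] P w ≡ [ j ] × j ≤ i + 1))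

  -- `walks` and `new` serve soundness of the labels, `old` their persistence, and `root` and
  -- `explored` the completeness of the search.
  record Invariant (st : State n) : Set where
    open State st
    field
      level    : ℕ
      frontier : Frontier level P queue
      walks    : Walks P
      root     : P r ≡ [ 0 ]
      explored : ∀ {u i} → P u ≡ [ i ] → u ∈ queue ⊎ Done P L u i
      old      : ∀ {u e} → e ∈ L₀ u → e ∈ L u
      new      : ∀ {u e} → e ∈ L u → e ∈ L₀ u ⊎ ∃[ i ] e ≡ (r , [ i ]) × Walk G i r u

  Done-≔ : ∀ {P L u i w k} → P w ≡ ∞ → Done P L u i → Done (P [ w ≔ [ k ] ]) L u i
  Done-≔ Pw (inj₁ pruned) = inj₁ pruned
  Done-≔ {P} {w = w} Pw (inj₂ (e∈ , next)) =
    inj₂ (e∈ , λ a → let j , Pj , j≤ = next a in j , ≔-finite P w Pw Pj , j≤)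

  init-invariant : Invariant init
  init-invariant = record
    { level    = 0
    ; frontier = record
        { front = r ∷ [] ; back = [] ; queue≡ = refl
        ; front-at = updateAt-updates r (const ∞) ∷ [] ; back-at = []
        ; bound = λ eq → root-bound (only-root eq) }
    ; walks    = λ eq → root-walk (only-root eq)
    ; root     = updateAt-updates r (const ∞)
    ; explored = λ eq → inj₁ (here (proj₁ (only-root eq)))
    ; old      = λ e∈ → e∈
    ; new      = inj₁ }
    where
    only-root : ∀ {u i} → (const ∞ [ r ≔ [ 0 ] ]) u ≡ [ i ] → u ≡ r × i ≡ 0
    only-root eq with ≔-inv (const ∞) r eq
    ... | inj₁ (u≡r , refl) = u≡r , refl

    root-bound : ∀ {u i} → u ≡ r × i ≡ 0 → i ≤ 1
    root-bound (_ , refl) = z≤n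

    root-walk : ∀ {u i} → u ≡ r × i ≡ 0 → Walk G i r u
    root-walk (refl , refl) = []

  step-invariant : ∀ {P u q L} → Invariant ⟨ P , u ∷ q , L ⟩ →
                   Invariant (step u ⟨ P , q , L ⟩)
  step-invariant {P} {u} {q} {L} inv
    with dequeue (Invariant.frontier inv) | Query r u L₀ ≤∞? P u
  ... | m , Pu , frontier | yes pruned = record
    { Invariant inv hiding (level; frontier; explored)
    ; frontier = frontier
    ; explored = λ eq → explored′ eq (Invariant.explored inv eq) }
    where
    explored′ : ∀ {v i} → P v ≡ [ i ] → v ∈ u ∷ q ⊎ Done P L v i → v ∈ q ⊎ Done P L v i
    explored′ eq (inj₁ (here refl)) = inj₂ (inj₁ (subst (Query r u L₀ ≤∞_) eq pruned))
    explored′ eq (inj₁ (there v∈))  = inj₁ v∈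
    explored′ eq (inj₂ done)        = inj₂ done
  -- Rewriting by `Pu` lets the value `P u +∞ [ 1 ]` given to the scan compute to `[ m + 1 ]`.
  ... | m , Pu , frontier | no _ rewrite Pu = record
    { level = m ; frontier = frontier′ ; walks = walks′
    ; root = scan-finite (N u) P q root ; explored = explored′
    ; old = old′ ; new = new′ }
    where
    open Invariant inv using (walks; root; explored; old; new)

    P′ = proj₁ (scan [ m + 1 ] (N u) P q)
    q′ = proj₂ (scan [ m + 1 ] (N u) P q)
    L′ = L [ u ≔ (r , [ m ]) ∷ L₀ u ]

    frontier′ : Frontier m P′ q′
    frontier′ = scan-preserves (Frontier m) (N u) (λ _ → enqueue) P q frontier

    walks′ : Walks P′
    walks′ = scan-preserves (λ P _ → Walks P) (N u) (λ {P} → pres {P}) P q walks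
      where
      pres : ∀ {P w} → w ∈ N u → P w ≡ ∞ → Walks P → Walks (P [ w ≔ [ m + 1 ] ])
      pres {P} {w = w} w∈ _ walksP eq with ≔-inv P w eq
      ... | inj₁ (refl , refl) = snoc (walks Pu) (Equivalence.to (∈N⇔Adj u w) w∈)
      ... | inj₂ eq′           = walksP eq′

    -- During the scan `u` is out of the queue but not yet done, so it is exempted; the label of `u`
    -- is still the one in `L`.
    ExploredUpToU : Distances n → List (Fin n) → Set
    ExploredUpToU P q = ∀ {v i} → P v ≡ [ i ] → v ≡ u ⊎ v ∈ q ⊎ Done P L v i

    exploredUpToU : ExploredUpToU P′ q′
    exploredUpToU = scan-preserves ExploredUpToU (N u) pres P q start
      where
      start : ExploredUpToU P q
      start eq with explored eq
      ... | inj₁ (here v≡u) = inj₁ v≡u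
      ... | inj₁ (there v∈) = inj₂ (inj₁ v∈)
      ... | inj₂ done       = inj₂ (inj₂ done)

      pres : ∀ {P q w} → w ∈ N u → P w ≡ ∞ → ExploredUpToU P q →
             ExploredUpToU (P [ w ≔ [ m + 1 ] ]) (q ++ w ∷ [])
      pres {P} {q} {w} _ Pw ex eq with ≔-inv P w eq
      ... | inj₁ (refl , _) = inj₂ (inj₁ (∈-++⁺ʳ q (here refl)))
      ... | inj₂ eq′ with ex eq′
      ...   | inj₁ v≡u         = inj₁ v≡u
      ...   | inj₂ (inj₁ v∈)   = inj₂ (inj₁ (∈-++⁺ˡ v∈))
      ...   | inj₂ (inj₂ done) = inj₂ (inj₂ (Done-≔ {L = L} Pw done))

    u-done : ∀ {i} → P′ u ≡ [ i ] → Done P′ L′ u i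
    u-done eq with []-injective (trans (sym eq) (scan-finite (N u) P q Pu))
    ... | refl = inj₂ (subst (_ ∈_) (sym (updateAt-updates u L)) (here refl) , next)
      where
      next : ∀ {w} → Adj u w → ∃[ j ] P′ w ≡ [ j ] × j ≤ m + 1
      next {w} a =
        -- A neighbour may have been reached before this scan; the frontier bound still keeps its
        -- value within `m + 1`.
        let j , eq = scan-covers (N u) P q (Equivalence.from (∈N⇔Adj u w) a)
        in j , eq , Frontier.bound frontier′ eq

    Done-L′ : ∀ {v i} → ¬ v ≡ u → Done P′ L v i → Done P′ L′ v i
    Done-L′ v≢u (inj₁ pruned)       = inj₁ pruned
    Done-L′ {v} v≢u (inj₂ (e∈ , next)) =
      inj₂ (subst (_ ∈_) (sym (updateAt-minimal v u L v≢u)) e∈ , next)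

    explored′ : ∀ {v i} → P′ v ≡ [ i ] → v ∈ q′ ⊎ Done P′ L′ v i
    explored′ {v} eq with v ≟ u
    ... | yes refl = inj₂ (u-done eq)
    ... | no v≢u with exploredUpToU eq
    ...   | inj₁ v≡u         = contradiction v≡u v≢u
    ...   | inj₂ (inj₁ v∈)   = inj₁ v∈
    ...   | inj₂ (inj₂ done) = inj₂ (Done-L′ v≢u done)

    old′ : ∀ {v e} → e ∈ L₀ v → e ∈ L′ v
    old′ {v} e∈ with ≔-inv L u {v = v} refl
    -- The label of `u` is rebuilt from `L₀ u`, so old entries form its tail.
    ... | inj₁ (refl , eq) = subst (_ ∈_) eq (there e∈)
    ... | inj₂ eq          = subst (_ ∈_) eq (old e∈)

    new′ : ∀ {v e} → e ∈ L′ v → e ∈ L₀ v ⊎ ∃[ i ] e ≡ (r , [ i ]) × Walk G i r v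
    new′ {v} e∈ with ≔-inv L u {v = v} refl
    ... | inj₂ eq          = new (subst (_ ∈_) (sym eq) e∈)
    ... | inj₁ (refl , eq) with subst (_ ∈_) (sym eq) e∈
    ...   | here refl = inj₂ (m , refl , walks Pu)
    ...   | there e∈′ = inj₁ e∈′

  loop-invariant : ∀ st ac → Invariant st →
                   Invariant (loop st ac) × State.queue (loop st ac) ≡ []
  loop-invariant ⟨ P , [] , L ⟩    _        inv = inv , refl
  loop-invariant ⟨ P , u ∷ q , L ⟩ (acc rs) inv =
    loop-invariant _ (rs (step-decreases u P q L)) (step-invariant inv)

  final : State n
  final = loop init (<-wellFounded _)

  final-invariant : Invariant final
  final-invariant = proj₁ (loop-invariant init (<-wellFounded _) init-invariant)

  final-queue : State.queue final ≡ []
  final-queue = proj₂ (loop-invariant init (<-wellFounded _) init-invariant)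

  open Invariant final-invariant public using (old; new)

  -- Follow the walk: at each vertex, its value `i` plus the remaining length `l` stays at most `a`.
  -- The search may have come to `u` by another walk than `p`, so pruning is excluded on all walks
  -- through `u` within this bound.
  reached : ∀ {w a} →
    (∀ {u i l} → Walk G i r u → Walk G l u w → i + l ≤ a → ¬ Query r u L₀ ≤∞ [ i ]) →
    Walk G a r w → ∃[ i ] i ≤ a × (r , [ i ]) ∈ result w
  reached {w} {a} unpruned p = follow 0 root p ≤-refl
    where
    open State final using (P; L)
    open Invariant final-invariant using (walks; root; explored)

    done : ∀ {u i} → P u ≡ [ i ] → Done P L u i
    done eq with explored eq
    ... | inj₂ d  = d
    ... | inj₁ u∈ with subst (_ ∈_) final-queue u∈
    ...   | ()

    follow : ∀ {u l} i → P u ≡ [ i ] → Walk G l u w → i + l ≤ a →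
             ∃[ i ] i ≤ a × (r , [ i ]) ∈ L w
    follow i Pu p i+l≤a with done Pu
    follow i Pu p i+l≤a | inj₁ pruned = contradiction pruned (unpruned (walks Pu) p i+l≤a)
    follow i Pu [] i+l≤a | inj₂ (e∈ , _) = i , ≤-trans (m≤m+n i 0) i+l≤a , e∈
    follow i Pu (_∷_ {k} e p) i+l≤a | inj₂ (_ , next) =
      let j , Pj , j≤ = next e in
      follow j Pj p (≤-trans (+-monoˡ-≤ k j≤)
        (≤-trans (≤-reflexive (+-assoc i 1 k)) i+l≤a))

-- Correctness of the whole labeling

module _ {G : Graph n} (nbrs : NeighbourLists G) (v : Permutation′ n) where

  open PrunedLandmarkLabeling nbrs v

  rank : Fin n → ℕ
  rank x = toℕ (v ⟨$⟩ˡ x)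

  -- The rank bound is carried along because a hub that causes pruning must precede the current
  -- root.
  L′-sound : ∀ k (k≤n : k ≤ n) {u x δ} → (x , δ) ∈ L′ k k≤n u →
             rank x < k × ∃[ i ] δ ≡ [ i ] × Walk G i x u
  L′-sound (suc k) k<n e∈
    with BFSCorrectness.new nbrs (v ⟨$⟩ʳ fromℕ< k<n) (L′ k (<⇒≤ k<n)) e∈
  ... | inj₁ e∈′ = let x<k , p = L′-sound k (<⇒≤ k<n) e∈′ in m≤n⇒m≤1+n x<k , p
  ... | inj₂ (i , refl , p) =
    ≤-reflexive (cong suc (trans (cong toℕ (inverseˡ v)) (toℕ-fromℕ< k<n))) , i , refl , p

  L′-mono : ∀ {j k} (j≤n : j ≤ n) (k≤n : k ≤ n) → j ≤ k → ∀ {u e} →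
            e ∈ L′ j j≤n u → e ∈ L′ k k≤n u
  L′-mono {j} {k} j≤n k≤n j≤k e∈ with m≤n⇒m<n∨m≡n j≤k
  -- The index takes a proof of `j ≤ n` as argument; any two such proofs are equal.
  L′-mono {j} {k} j≤n k≤n j≤k e∈ | inj₂ refl rewrite ≤-irrelevant j≤n k≤n = e∈
  L′-mono {j} {suc k} j≤n k<n j≤k e∈ | inj₁ (s≤s j≤k′) =
    BFSCorrectness.old nbrs (v ⟨$⟩ʳ fromℕ< k<n) (L′ k (<⇒≤ k<n))
      (L′-mono j≤n (<⇒≤ k<n) j≤k′ e∈)

  Query-walks : ∀ k (k≤n : k ≤ n) {s t d} → Query s t (L′ k k≤n) ≡ [ d ] →
    ∃[ x ] ∃[ i ] ∃[ j ] rank x < k × Walk G i x s × Walk G j x t × i + j ≡ d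
  Query-walks k k≤n {s} {t} eq with Query-attained (L′ k k≤n) s t eq
  ... | x , δₛ , δₜ , s∋ , t∋ , eq′ with L′-sound k k≤n s∋ | L′-sound k k≤n t∋
  ...   | x<k , i , refl , p | _ , j , refl , q = x , i , j , x<k , p , q , []-injective eq′

  Good : ℕ → Fin n → Fin n → Fin n → Set
  Good k s t x = ∃[ a ] ∃[ b ] Walk G a x s × Walk G b x t × a + b ≤ k

  Good-sym : ∀ {k s t x} → Good k s t x → Good k t s x
  Good-sym {k} (a , b , p , q , a+b≤k) = b , a , q , p , subst (_≤ k) (+-comm a b) a+b≤k

  hub-in-round : ∀ {k s t} j (j<n : j < n) {x} → v ⟨$⟩ʳ fromℕ< j<n ≡ x →
    (∀ {y} → rank y < j → ¬ Good k s t y) →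
    ∀ {a b} → Walk G a x s → Walk G b x t → a + b ≤ k →
    ∃[ i ] i ≤ a × (x , [ i ]) ∈ L′ (suc j) j<n s
  hub-in-round {k} {s} {t} j j<n {x} refl none {a} {b} p q a+b≤k =
    BFSCorrectness.reached nbrs x (L′ j (<⇒≤ j<n)) unpruned p
    where
    unpruned : ∀ {u i l} → Walk G i x u → Walk G l u s → i + l ≤ a →
               ¬ Query x u (L′ j (<⇒≤ j<n)) ≤∞ [ i ]
    unpruned {u} {i} {l} _ us i+l≤a Q≤i =
      let d , Q≡d , d≤i = ≤∞-finite Q≤i
          y , e , f , y<j , yx , yu , e+f≡d = Query-walks j (<⇒≤ j<n) Q≡d
      -- The pruning hub `y` reaches `s` through `u` and `t` through `x`; since `e + f ≤ i`, the
      -- total does not exceed `a + b`.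
      in none y<j (f + l , e + b , yu ++ʷ us , yx ++ʷ q , (begin
        (f + l) + (e + b)  ≡⟨ rearrange e f l b ⟩
        (e + f) + l + b    ≡⟨ cong (λ d → d + l + b) e+f≡d ⟩
        d + l + b          ≤⟨ +-monoˡ-≤ b (+-monoˡ-≤ l d≤i) ⟩
        i + l + b          ≤⟨ +-monoˡ-≤ b i+l≤a ⟩
        a + b              ≤⟨ a+b≤k ⟩
        k                  ∎))
      where
      open ≤-Reasoning

      rearrange : ∀ e f l b → (f + l) + (e + b) ≡ (e + f) + l + b
      rearrange = solve-∀

  -- The entry is made in the round that processes `x` and survives all later rounds.
  hub : ∀ {k s t x} → (∀ {y} → rank y < rank x → ¬ Good k s t y) →
        ∀ {a b} → Walk G a x s → Walk G b x t → a + b ≤ k →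
        ∃[ i ] i ≤ a × (x , [ i ]) ∈ L′ₙ s
  hub {x = x} none p q a+b≤k =
    let x<n = toℕ<n (v ⟨$⟩ˡ x)
        x-at-rank = trans (cong (v ⟨$⟩ʳ_) (fromℕ<-toℕ (v ⟨$⟩ˡ x) x<n)) (inverseʳ v)
        i , i≤a , e∈ = hub-in-round (rank x) x<n x-at-rank none p q a+b≤k
    in i , i≤a , L′-mono x<n ≤-refl x<n e∈

  -- The least good vertex is not chosen explicitly: if the bound failed, induction on rank would
  -- rule out every good vertex, yet `s` is good by the empty walk and `p`.
  Query-complete : ∀ {k s t} → Walk G k s t → Query s t L′ₙ ≤∞ [ k ]
  Query-complete {k} {s} {t} p = decidable-stable (Query s t L′ₙ ≤∞? [ k ]) λ Q≰k →
    noneGood Q≰k s (<-wellFounded (rank s)) (0 , k , [] , p , ≤-refl)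
    where
    noneGood : ¬ Query s t L′ₙ ≤∞ [ k ] → ∀ x → Acc _<_ (rank x) → ¬ Good k s t x
    noneGood Q≰k x (acc rs) good@(a , b , p , q , a+b≤k) =
      let none : ∀ {y} → rank y < rank x → ¬ Good k s t y
          none {y} y<x = noneGood Q≰k y (rs y<x)
          i , i≤a , s∋ = hub none p q a+b≤k
          -- Goodness is symmetric, so the same argument with `s` and `t` exchanged gives the label
          -- of `t`.
          j , j≤b , t∋ = hub (λ y<x → none y<x ∘ Good-sym) q p
                             (subst (_≤ k) (+-comm a b) a+b≤k)
      in Q≰k (≤⁺-trans ≤-trans (Query-≤ L′ₙ s t s∋ t∋)
                       [ ≤-trans (+-mono-≤ i≤a j≤b) a+b≤k ])

  Query-isDistance : ∀ s t → IsDistance G s t (Query s t L′ₙ)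
  Query-isDistance s t with Query s t L′ₙ in eq
  ... | [ k ] = walk , λ j p → [≤]-injective (subst (_≤∞ [ j ]) eq (Query-complete p))
    where
    walk : Walk G k s t
    walk = let _ , _ , _ , _ , xs , xt , i+j≡k = Query-walks n ≤-refl eq
           in subst (λ k → Walk G k s t) i+j≡k (reverseʷ xs ++ʷ xt)
  -- A walk of length `k` would bound the query by `[ k ]`, which `∞` exceeds.
  ... | ∞ = λ k p → contradiction (subst (_≤∞ [ k ]) eq (Query-complete p)) λ ()

corollary4p1 : ∀ {n : ℕ} (G : Graph n) (nbrs : NeighbourLists G) (v : Permutation′ n) (s t : Fin n) →
    Query s t (PrunedLandmarkLabeling.L′ₙ nbrs v) ≡ d G s t
corollary4p1 G nbrs v s t =
  IsDistance-unique G (Query-isDistance nbrs v s t) (proj₂ (distance G s t))
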